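{- Let $R\subseteq\mathbb Q$ be an infinite set such that there exist computable functions $\tau_1,\tau_2\colon\mathbb N\to\mathbb Z$ with $\tau_2(k)\neq0$ for all $k\in\mathbb N$ and $\{\tau_1(k)/\tau_2(k):k\in\mathbb N\}=R$. If the set of all Diophantine equations which have at most finitely many solutions in $R$ is recursively enumerable, then there exists an algorithm which decides, for any given Diophantine equation, whether or not it has a solution in $R$.
   Context: $\mathbb N=\{0,1,2,\ldots\}$. A Diophantine equation is an equation $D(x_1,\ldots,x_n)=0$ with $D\in\mathbb Z[x_1,\ldots,x_n]$ for some $n\ge1$; such equations are coded as natural numbers so that recursiveness and recursive enumerability of sets of them make sense. A solution in $R$ means a tuple in $R^n$. -}

module Defs where

open import Algebra.Definitions.RawSemiring using () renaming (_^_ to pow)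
open import Axiom.ExcludedMiddle using (ExcludedMiddle)
open import Data.Fin.Base using (Fin)
open import Data.Integer.Base as ℤ using (ℤ; +_; -[1+_]; 0ℤ)
open import Data.List.Base as List using (List; []; _∷_)
open import Data.List.Membership.Propositional using (_∈_)
open import Data.List.Properties using (∷-injective)
open import Data.Nat.Base using (ℕ; zero; suc; _+_; _*_; _^_; _<_)
open import Data.Nat.Properties
  using (even≢odd; suc-injective; *-cancelˡ-≡; *-assoc; *-identityˡ)
open import Data.Product.Base using (Σ; ∃; ∃₂; _×_; _,_; proj₁; proj₂)
open import Data.Rational.Base as ℚ using (ℚ; 0ℚ; 1ℚ)
open import Data.Rational.Literals using (fromℤ)
open import Data.Vec.Base as Vec using (Vec; []; _∷_)
open import Data.Vec.Properties using (toList-injective; cast-is-id)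
open import Data.Vec.Relation.Binary.Pointwise.Inductive using (Pointwise)
open import Data.Vec.Relation.Unary.All using (All)
open import Function.Bundles using (_⇔_; Equivalence)
open import Function.Definitions using (Injective)
open import Level using (_⊔_)
open import Relation.Binary.PropositionalEquality
  using (_≡_; _≢_; refl; sym; trans; cong; cong₂)
open import Relation.Nullary using (¬_; yes; no; contradiction)
open import Relation.Unary using (Pred)

data Rec : ℕ → Set where
  zeroᵣ : ∀ {n} → Rec n
  sucᵣ  : Rec 1
  projᵣ : ∀ {n} → Fin n → Rec n
  compᵣ : ∀ {m n} → Rec m → Vec (Rec n) m → Rec n
  primᵣ : ∀ {n} → Rec n → Rec (2 + n) → Rec (1 + n)
  minᵣ  : ∀ {n} → Rec (1 + n) → Rec n

-- f ⟨ xs ⟩⇓ y : the computation of f on input xs halts with output y.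
-- The recursion variable comes first; the step function of primᵣ receives
-- the predecessor, then the previous value, then the parameters.

infix 4 _⟨_⟩⇓_

data _⟨_⟩⇓_ : ∀ {n} → Rec n → Vec ℕ n → ℕ → Set where
  zero⇓ : ∀ {n} {xs : Vec ℕ n} → zeroᵣ ⟨ xs ⟩⇓ 0
  suc⇓  : ∀ {x} → sucᵣ ⟨ x ∷ [] ⟩⇓ suc x
  proj⇓ : ∀ {n} {i : Fin n} {xs} → projᵣ i ⟨ xs ⟩⇓ Vec.lookup xs i
  comp⇓ : ∀ {m n} {f : Rec m} {gs : Vec (Rec n) m} {xs ys z} →
          Pointwise (λ g y → g ⟨ xs ⟩⇓ y) gs ys →
          f ⟨ ys ⟩⇓ z →
          compᵣ f gs ⟨ xs ⟩⇓ z
  primZ⇓ : ∀ {n} {f : Rec n} {g xs y} →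
           f ⟨ xs ⟩⇓ y →
           primᵣ f g ⟨ 0 ∷ xs ⟩⇓ y
  primS⇓ : ∀ {n} {f : Rec n} {g k xs y z} →
           primᵣ f g ⟨ k ∷ xs ⟩⇓ y →
           g ⟨ k ∷ y ∷ xs ⟩⇓ z →
           primᵣ f g ⟨ suc k ∷ xs ⟩⇓ z
  min⇓  : ∀ {n} {f : Rec (1 + n)} {xs k} →
          (∀ i → i < k → ∃ λ y → f ⟨ i ∷ xs ⟩⇓ suc y) →
          f ⟨ k ∷ xs ⟩⇓ 0 →
          minᵣ f ⟨ xs ⟩⇓ k

Halts : ∀ {n} → Rec n → Vec ℕ n → Set
Halts f xs = ∃ λ y → f ⟨ xs ⟩⇓ y

RecursivelyEnumerable : ∀ {ℓ} → Pred ℕ ℓ → Set ℓ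
RecursivelyEnumerable S = ∃ λ (p : Rec 1) → ∀ x → S x ⇔ Halts p (x ∷ [])

AtMostFinite : ∀ {a ℓ} {A : Set a} → Pred A ℓ → Set (a ⊔ ℓ)
AtMostFinite {A = A} P = ∃ λ (l : List A) → ∀ x → P x → x ∈ l

Infinite : ∀ {a ℓ} {A : Set a} → Pred A ℓ → Set (a ⊔ ℓ)
Infinite P = ¬ AtMostFinite P

-- A coefficient together with the exponents of x₁, …, xₙ.
Term : ℕ → Set
Term n = ℤ × Vec ℕ n

-- An element of ℤ[x₁,…,xₙ] written as a formal sum of terms.  Several lists
-- may denote the same polynomial (no order or distinctness is imposed).
Polynomial : ℕ → Set
Polynomial n = List (Term n)

infixr 8 _^ℚ_
_^ℚ_ : ℚ → ℕ → ℚ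
_^ℚ_ = pow ℚ.+-*-rawSemiring

evalTerm : ∀ {n} → Term n → Vec ℚ n → ℚ
evalTerm (c , es) xs =
  fromℤ c ℚ.* Vec.foldr′ ℚ._*_ 1ℚ (Vec.zipWith _^ℚ_ xs es)

eval : ∀ {n} → Polynomial n → Vec ℚ n → ℚ
eval ts xs = List.foldr (λ t s → evalTerm t xs ℚ.+ s) 0ℚ ts

-- (m , D) is the equation D(x₁,…,xₙ) = 0 with n = suc m ≥ 1.
Equation : Set
Equation = Σ ℕ λ m → Polynomial (suc m)

SolutionIn : ∀ {ℓ} → Pred ℚ ℓ → (E : Equation) → Pred (Vec ℚ (suc (proj₁ E))) ℓ
SolutionIn R (m , D) xs = All R xs × eval D xs ≡ 0ℚ

HasSolutionIn : ∀ {ℓ} → Pred ℚ ℓ → Pred Equation ℓ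
HasSolutionIn R E = ∃ (SolutionIn R E)

AtMostFinitelyManySolutionsIn : ∀ {ℓ} → Pred ℚ ℓ → Pred Equation ℓ
AtMostFinitelyManySolutionsIn R E = AtMostFinite (SolutionIn R E)

codeℤ : ℤ → ℕ
codeℤ (+ n)    = 2 * n
codeℤ -[1+ n ] = suc (2 * n)

-- (a , b) ↦ 2ᵃ(2b+1) is a bijection from ℕ × ℕ to the positive integers.
codeList : List ℕ → ℕ
codeList []      = 0
codeList (a ∷ l) = 2 ^ a * suc (2 * codeList l)

codeTerm : ∀ {n} → Term n → ℕ
codeTerm (c , es) = codeList (codeℤ c ∷ Vec.toList es)

code : Equation → ℕ
code (m , D) = codeList (suc m ∷ List.map codeTerm D)

private
  codeℤ-injective : Injective _≡_ _≡_ codeℤ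
  codeℤ-injective {+ m}      {+ n}      eq = cong +_ (*-cancelˡ-≡ m n 2 eq)
  codeℤ-injective {+ m}      { -[1+ n ]} eq = contradiction eq (even≢odd m n)
  codeℤ-injective { -[1+ m ]} {+ n}      eq = contradiction (sym eq) (even≢odd n m)
  codeℤ-injective { -[1+ m ]} { -[1+ n ]} eq =
    cong -[1+_] (*-cancelˡ-≡ m n 2 (suc-injective eq))

  pair-injective : ∀ a b {x y} → 2 ^ a * suc (2 * x) ≡ 2 ^ b * suc (2 * y) →
                   a ≡ b × x ≡ y
  pair-injective zero zero {x} {y} eq = refl , *-cancelˡ-≡ x y 2 (suc-injective
    (trans (sym (*-identityˡ _)) (trans eq (*-identityˡ _))))
  pair-injective zero (suc b) {x} {y} eq = contradiction
    (trans (sym (*-assoc 2 (2 ^ b) _)) (trans (sym eq) (*-identityˡ _)))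
    (even≢odd (2 ^ b * suc (2 * y)) x)
  pair-injective (suc a) zero {x} {y} eq = contradiction
    (trans (sym (*-assoc 2 (2 ^ a) _)) (trans eq (*-identityˡ _)))
    (even≢odd (2 ^ a * suc (2 * x)) y)
  pair-injective (suc a) (suc b) {x} {y} eq
    with pair-injective a b {x} {y} (*-cancelˡ-≡ _ _ 2
           (trans (sym (*-assoc 2 (2 ^ a) _)) (trans eq (*-assoc 2 (2 ^ b) _))))
  ... | refl , x≡y = refl , x≡y

  pair≢0 : ∀ a {x} → 2 ^ a * suc (2 * x) ≢ 0
  pair≢0 zero    ()
  pair≢0 (suc a) {x} eq = pair≢0 a {x} (*-cancelˡ-≡ _ 0 2
    (trans (sym (*-assoc 2 (2 ^ a) _)) eq))

  codeList-injective : Injective _≡_ _≡_ codeList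
  codeList-injective {[]}    {[]}    eq = refl
  codeList-injective {[]}    {b ∷ m} eq = contradiction (sym eq) (pair≢0 b {codeList m})
  codeList-injective {a ∷ l} {[]}    eq = contradiction eq (pair≢0 a {codeList l})
  codeList-injective {a ∷ l} {b ∷ m} eq with pair-injective a b {codeList l} {codeList m} eq
  ... | a≡b , eq′ = cong₂ _∷_ a≡b (codeList-injective eq′)

  codeTerm-injective : ∀ {n} → Injective _≡_ _≡_ (codeTerm {n})
  codeTerm-injective {n} {c , es} {d , fs} eq
    with ∷-injective (codeList-injective {codeℤ c ∷ Vec.toList es}
                         {codeℤ d ∷ Vec.toList fs} eq)
  ... | c≡d , es≡fs = cong₂ _,_ (codeℤ-injective c≡d)
    (trans (sym (cast-is-id refl es)) (toList-injective refl es fs es≡fs))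

  map-codeTerm-injective : ∀ {n} → Injective _≡_ _≡_ (List.map (codeTerm {n}))
  map-codeTerm-injective {n} {[]}    {[]}    eq = refl
  map-codeTerm-injective {n} {s ∷ D} {t ∷ E} eq with ∷-injective eq
  ... | s≡t , D≡E = cong₂ _∷_ (codeTerm-injective s≡t) (map-codeTerm-injective D≡E)

code-injective : Injective _≡_ _≡_ code
code-injective {m , D} {n , E} eq
  with ∷-injective (codeList-injective {suc m ∷ List.map codeTerm D}
                         {suc n ∷ List.map codeTerm E} eq)
... | refl , D≡E = cong (m ,_) (map-codeTerm-injective D≡E)

Codes : ∀ {ℓ} → Pred Equation ℓ → Pred ℕ ℓ
Codes S x = ∃ λ E → S E × code E ≡ x

Computable : (ℕ → ℤ) → Set
Computable τ = ∃ λ (p : Rec 1) → ∀ k → p ⟨ k ∷ [] ⟩⇓ codeℤ (τ k)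

-- Answer 1 means yes, answer 0 means no.  Classically one of the two clauses
-- applies to every equation, so the algorithm always halts; see decides⇒halts.
Decides : ∀ {ℓ} → Rec 1 → Pred Equation ℓ → Set ℓ
Decides p S = ∀ E →
  (S E ⇔ p ⟨ code E ∷ [] ⟩⇓ 1) × ((¬ S E) ⇔ p ⟨ code E ∷ [] ⟩⇓ 0)

decides⇒halts : ∀ {ℓ} → ExcludedMiddle ℓ → ∀ {p} {S : Pred Equation ℓ} →
                Decides p S → ∀ E → Halts p (code E ∷ [])
decides⇒halts em {S = S} d E with em {S E}
... | yes s = 1 , Equivalence.to (proj₁ (d E)) s
... | no ¬s = 0 , Equivalence.to (proj₂ (d E)) ¬s

quotient : (a b : ℤ) → b ≢ 0ℤ → ℚ
quotient a b b≢0 = ℚ._÷_ (fromℤ a) (fromℤ b) {{ℤ.≢-nonZero b≢0}}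

ComputablyPresented : ∀ {ℓ} → Pred ℚ ℓ → Set ℓ
ComputablyPresented R = ∃₂ λ (τ₁ τ₂ : ℕ → ℤ) →
  Computable τ₁ × Computable τ₂ ×
  Σ (∀ k → τ₂ k ≢ 0ℤ) λ τ₂≢0 →
    ∀ q → R q ⇔ ∃ λ k → quotient (τ₁ k) (τ₂ k) (τ₂≢0 k) ≡ q

{-# OPTIONS --safe #-}

-- Adding an unused variable to D gives an equation D′ with a solution in R for
-- every solution of D and every element of R.  As R is infinite, D′ has at most
-- finitely many solutions exactly when D has none.  So run two searches in
-- parallel: one over all tuples from R for a solution of D, the other for an
-- acceptance of D′ by the given enumeration, run with ever larger bounds on its
-- minimisations.

module Submission where

open import Defs
open import Data.Fin.Base using (Fin; zero; suc)
open import Data.Integer.Base as ℤ using (ℤ; +_; -[1+_]; +[1+_]; 0ℤ)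
import Data.Integer.Properties as ℤ
open import Data.Integer.Tactic.RingSolver using (solve-∀)
open import Data.List.Base as List using (List; []; _∷_; length)
open import Data.List.Membership.Propositional.Properties using (∈-map⁺)
open import Data.Nat.Base
open import Data.Nat.Properties
open import Data.Product.Base using (∃; ∃₂; _×_; _,_; proj₁; proj₂)
open import Data.Rational.Base as ℚ using (ℚ; 0ℚ; 1ℚ; toℚᵘ)
open import Data.Rational.Literals using (fromℤ)
import Data.Rational.Properties as ℚ
open import Data.Rational.Unnormalised.Base as ℚᵘ using (ℚᵘ; mkℚᵘ; _≃_)
import Data.Rational.Unnormalised.Properties as ℚᵘ
open import Data.Sum.Base using (_⊎_; inj₁; inj₂)
open import Data.Vec.Base as Vec using (Vec; []; _∷_; head; tail; lookup)
open import Data.Vec.Relation.Binary.Pointwise.Inductive using (Pointwise; []; _∷_)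
open import Data.Vec.Relation.Unary.All using (All; []; _∷_)
open import Function.Bundles using (_⇔_; mk⇔; Equivalence)
open import Relation.Binary.PropositionalEquality
open import Relation.Nullary using (¬_; contradiction)
open import Relation.Unary using (Pred)

-- The given program may diverge on `D′`, so calling it inside a search could block the search for a
-- solution. Minimisation is the only source of divergence, and the program is fixed. Recursion over
-- its syntax therefore turns it into a total function `evalBelow` of the bound and the input. Both
-- searches become zero tests of total recursive functions of one number `t`, and a single
-- minimisation over the product of the tests serves every equation. The `t` at which it stops
-- certifies the answer: it yields a solution of `D` or an acceptance of `D′`. What remains is to
-- show that evaluating a coded polynomial at a coded tuple is recursive.

private variable
  m n : ℕ

-- Recursive functions and their closure properties

record Recursive (f : Vec ℕ n → ℕ) : Set where
  constructor computedBy
  field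
    program  : Rec n
    computes : ∀ xs → program ⟨ xs ⟩⇓ f xs

open Recursive

record Recursives (F : Vec ℕ n → Vec ℕ m) : Set where
  constructor computedBy
  field
    programs : Vec (Rec n) m
    computes : ∀ xs → Pointwise (λ p y → p ⟨ xs ⟩⇓ y) programs (F xs)

open Recursives

-- Quantifying over an inner function of any arity makes recursiveness proofs compose by
-- application, so that a proof has the same shape as the expression it is about.
Recursive₁ : (ℕ → ℕ) → Set
Recursive₁ f = ∀ {n} {g : Vec ℕ n → ℕ} → Recursive g → Recursive λ xs → f (g xs)

Recursive₂ : (ℕ → ℕ → ℕ) → Set
Recursive₂ f = ∀ {n} {g h : Vec ℕ n → ℕ} → Recursive g → Recursive h →
  Recursive λ xs → f (g xs) (h xs)

Recursive₃ : (ℕ → ℕ → ℕ → ℕ) → Set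
Recursive₃ f = ∀ {n} {g h i : Vec ℕ n → ℕ} →
  Recursive g → Recursive h → Recursive i → Recursive λ xs → f (g xs) (h xs) (i xs)

Recursive₄ : (ℕ → ℕ → ℕ → ℕ → ℕ) → Set
Recursive₄ f = ∀ {n} {g h i j : Vec ℕ n → ℕ} →
  Recursive g → Recursive h → Recursive i → Recursive j →
  Recursive λ xs → f (g xs) (h xs) (i xs) (j xs)

resp-≗ : {f g : Vec ℕ n → ℕ} → f ≗ g → Recursive f → Recursive g
resp-≗ f≗g (computedBy p p⇓) = computedBy p λ xs → subst (p ⟨ xs ⟩⇓_) (f≗g xs) (p⇓ xs)

var : (i : Fin n) → Recursive λ xs → lookup xs i
var i = computedBy (projᵣ i) λ _ → proj⇓

var₀ : Recursive {suc n} head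
var₀ = resp-≗ (λ { (_ ∷ _) → refl }) (var zero)

[]-rec : Recursives {n} λ _ → []
[]-rec = computedBy [] λ _ → []

infixr 5 _∷-rec_
_∷-rec_ : {f : Vec ℕ n → ℕ} {F : Vec ℕ n → Vec ℕ m} →
          Recursive f → Recursives F → Recursives λ xs → f xs ∷ F xs
computedBy p p⇓ ∷-rec computedBy ps ps⇓ =
  computedBy (p ∷ ps) λ xs → p⇓ xs ∷ ps⇓ xs

infixr 9 _∘-rec_ _∘ₛ-rec_
_∘-rec_ : {f : Vec ℕ m → ℕ} {F : Vec ℕ n → Vec ℕ m} →
          Recursive f → Recursives F → Recursive λ xs → f (F xs)
computedBy p p⇓ ∘-rec computedBy ps ps⇓ =
  computedBy (compᵣ p ps) λ xs → comp⇓ (ps⇓ xs) (p⇓ _)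

_∘ₛ-rec_ : ∀ {k} {F : Vec ℕ m → Vec ℕ k} {G : Vec ℕ n → Vec ℕ m} →
           Recursives F → Recursives G → Recursives λ xs → F (G xs)
_∘ₛ-rec_ {G = G} (computedBy ps ps⇓) (computedBy qs qs⇓) =
  computedBy (Vec.map (λ p → compᵣ p qs) ps) λ xs → go xs (ps⇓ (G xs))
  where
  go : ∀ xs {k} {ps : Vec (Rec _) k} {ys : Vec ℕ k} →
       Pointwise (λ p y → p ⟨ G xs ⟩⇓ y) ps ys →
       Pointwise (λ p y → p ⟨ xs ⟩⇓ y) (Vec.map (λ p → compᵣ p qs) ps) ys
  go xs []       = []
  go xs (d ∷ ds) = comp⇓ (qs⇓ xs) d ∷ go xs ds

tail-rec : Recursives {suc n} tail
tail-rec = computedBy (Vec.tabulate λ i → projᵣ (suc i)) λ { xs@(_ ∷ _) → go xs _ λ _ → refl }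
  where
  go : ∀ (xs : Vec ℕ n) {k} (ys : Vec ℕ k) {ι : Fin k → Fin n} →
       (∀ i → lookup xs (ι i) ≡ lookup ys i) →
       Pointwise (λ p y → p ⟨ xs ⟩⇓ y) (Vec.tabulate λ i → projᵣ (ι i)) ys
  go xs []       eq = []
  go xs (y ∷ ys) eq =
    subst (_ ⟨ xs ⟩⇓_) (eq zero) proj⇓ ∷ go xs ys (λ i → eq (suc i))

suc-rec : Recursive₁ suc
suc-rec g =
  computedBy {f = λ xs → suc (head xs)} sucᵣ (λ { (_ ∷ []) → suc⇓ }) ∘-rec (g ∷-rec []-rec)

lit : ∀ c → Recursive {n} λ _ → c
lit zero    = computedBy zeroᵣ λ _ → zero⇓
lit (suc c) = suc-rec (lit c)

-- `F` may be any function that satisfies the recursion equations pointwise, so functions defined by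
-- pattern matching obtain programs as they stand.
primRec : {b : Vec ℕ n → ℕ} {s : Vec ℕ (2 + n) → ℕ} (F : ℕ → Vec ℕ n → ℕ) →
            Recursive b → Recursive s →
            (∀ xs → b xs ≡ F 0 xs) →
            (∀ k xs → s (k ∷ F k xs ∷ xs) ≡ F (suc k) xs) →
            Recursive λ ys → F (head ys) (tail ys)
primRec {n = n} F (computedBy p p⇓) (computedBy q q⇓) base step =
  computedBy (primᵣ p q) λ { (k ∷ xs) → go k xs }
  where
  go : ∀ k (xs : Vec ℕ n) → primᵣ p q ⟨ k ∷ xs ⟩⇓ F k xs
  go zero    xs = primZ⇓ (subst (p ⟨ xs ⟩⇓_) (base xs) (p⇓ xs))
  go (suc k) xs = primS⇓ (go k xs) (subst (q ⟨ _ ⟩⇓_) (step k xs) (q⇓ _))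

prim₁ : (F : ℕ → ℕ) (s : ℕ → ℕ → ℕ) → Recursive₂ s →
        (∀ k → s k (F k) ≡ F (suc k)) → Recursive₁ F
prim₁ F _ s step g =
  primRec (λ k _ → F k) (lit (F 0)) (s (var zero) (var (suc zero)))
    (λ _ → refl) (λ k _ → step k)
  ∘-rec (g ∷-rec []-rec)

prim₂ : (F : ℕ → ℕ → ℕ) (b : ℕ → ℕ) (s : ℕ → ℕ → ℕ → ℕ) →
        Recursive₁ b → Recursive₃ s →
        (∀ x → b x ≡ F 0 x) → (∀ k x → s k (F k x) x ≡ F (suc k) x) → Recursive₂ F
prim₂ F _ _ b s base step g h =
  primRec (λ k xs → F k (lookup xs zero)) (b (var zero))
    (s (var zero) (var (suc zero)) (var (suc (suc zero))))
    (λ xs → base _) (λ k xs → step k _)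
  ∘-rec (g ∷-rec h ∷-rec []-rec)

prim₃ : (F : ℕ → ℕ → ℕ → ℕ) (b : ℕ → ℕ → ℕ) (s : ℕ → ℕ → ℕ → ℕ → ℕ) →
        Recursive₂ b → Recursive₄ s →
        (∀ x y → b x y ≡ F 0 x y) → (∀ k x y → s k (F k x y) x y ≡ F (suc k) x y) →
        Recursive₃ F
prim₃ F _ _ b s base step g h i =
  primRec (λ k xs → F k (lookup xs zero) (lookup xs (suc zero)))
    (b (var zero) (var (suc zero)))
    (s (var zero) (var (suc zero)) (var (suc (suc zero))) (var (suc (suc (suc zero)))))
    (λ xs → base _ _) (λ k xs → step k _ _)
  ∘-rec (g ∷-rec h ∷-rec i ∷-rec []-rec)

-- Basic arithmetic

+-rec : Recursive₂ _+_
+-rec = prim₂ _+_ (λ x → x) (λ _ y _ → suc y)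
  (λ g → g) (λ _ y _ → suc-rec y) (λ _ → refl) (λ _ _ → refl)

*-rec : Recursive₂ _*_
*-rec = prim₂ _*_ (λ _ → 0) (λ _ y x → x + y)
  (λ _ → lit 0) (λ _ y x → +-rec x y) (λ _ → refl) (λ _ _ → refl)

^-rec : Recursive₂ _^_
^-rec g h = prim₂ (λ k x → x ^ k) (λ _ → 1) (λ _ y x → x * y)
  (λ _ → lit 1) (λ _ y x → *-rec x y) (λ _ → refl) (λ _ _ → refl) h g

pred-rec : Recursive₁ pred
pred-rec = prim₁ pred (λ k _ → k) (λ k _ → k) (λ _ → refl)

∸-rec : Recursive₂ _∸_
∸-rec g h = prim₂ (λ k x → x ∸ k) (λ x → x) (λ _ y _ → pred y)
  (λ x → x) (λ _ y _ → pred-rec y) (λ _ → refl) (λ k x → pred[m∸n]≡m∸[1+n] x k) h g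

-- Evaluation of programs with bounded minimisation

ifZero : ℕ → ℕ → ℕ → ℕ
ifZero zero    a b = a
ifZero (suc _) a b = b

ifZero-rec : Recursive₃ ifZero
ifZero-rec = prim₃ ifZero (λ a _ → a) (λ _ _ _ b → b)
  (λ a _ → a) (λ _ _ _ b → b) (λ _ _ → refl) (λ _ _ _ → refl)

-- Values are shifted by one, with 0 for undefined, so the product vanishes exactly when some
-- argument of a composition is undefined.
product : Vec ℕ m → ℕ
product = Vec.foldr′ _*_ 1

-- `r` is a shifted value: 0 is undefined and 1 is the value zero. Getting stuck must be final,
-- since a zero found beyond an undefined value is not a result of `minᵣ`.
searchStep : ℕ → ℕ → ℕ → ℕ
searchStep i r s = ifZero s (ifZero r 1 (ifZero (pred r) (2 + i) 0)) s

-- State of a minimisation after trying the arguments below i: 0 while it is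
-- still running, 1 once it got stuck on an undefined value, 2 + k once it found k.
search : (ℕ → ℕ) → ℕ → ℕ
search f zero    = 0
search f (suc i) = searchStep i (f i) (search f i)

-- Evaluation in which every minimisation tries only the arguments below t:
-- 0 means undefined, suc y means the value y.
evalBelow     : Rec n → ℕ → Vec ℕ n → ℕ
evalAllBelow  : Vec (Rec n) m → ℕ → Vec ℕ n → Vec ℕ m
evalPrimBelow : Rec n → Rec (2 + n) → ℕ → ℕ → Vec ℕ n → ℕ

evalBelow zeroᵣ        t xs       = 1
evalBelow sucᵣ         t (x ∷ []) = suc (suc x)
evalBelow (projᵣ i)    t xs       = suc (lookup xs i)
evalBelow (compᵣ f gs) t xs       =
  ifZero (product (evalAllBelow gs t xs)) 0
    (evalBelow f t (Vec.map pred (evalAllBelow gs t xs)))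
evalBelow (primᵣ f g)  t (k ∷ xs) = evalPrimBelow f g t k xs
evalBelow (minᵣ f)     t xs       = pred (search (λ i → evalBelow f t (i ∷ xs)) t)

evalAllBelow []       t xs = []
evalAllBelow (g ∷ gs) t xs = evalBelow g t xs ∷ evalAllBelow gs t xs

evalPrimBelow f g t zero    xs = evalBelow f t xs
evalPrimBelow f g t (suc k) xs =
  ifZero (evalPrimBelow f g t k xs) 0
    (evalBelow g t (k ∷ pred (evalPrimBelow f g t k xs) ∷ xs))

searchStep-rec : Recursive₃ searchStep
searchStep-rec i r s = ifZero-rec s
  (ifZero-rec r (lit 1) (ifZero-rec (pred-rec r) (suc-rec (suc-rec i)) (lit 0))) s

-- Induction on the fixed program `f`, with the bound as a new first argument: every minimisation
-- turns into a primitive recursion whose length is the bound.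
evalBelow-rec : (f : Rec n) → Recursive λ ys → evalBelow f (head ys) (tail ys)
preds-rec     : (gs : Vec (Rec n) m) →
                Recursives λ ys → Vec.map pred (evalAllBelow gs (head ys) (tail ys))
product-rec   : (gs : Vec (Rec n) m) →
                Recursive λ ys → product (evalAllBelow gs (head ys) (tail ys))

evalBelow-rec zeroᵣ        = lit 1
evalBelow-rec sucᵣ         =
  resp-≗ (λ { (_ ∷ _ ∷ []) → refl }) (suc-rec (suc-rec (var (suc zero))))
evalBelow-rec (projᵣ i)    =
  resp-≗ (λ { (_ ∷ _) → refl }) (suc-rec (var (suc i)))
evalBelow-rec (compᵣ f gs) =
  ifZero-rec (product-rec gs) (lit 0) (evalBelow-rec f ∘-rec (var₀ ∷-rec preds-rec gs))
evalBelow-rec (primᵣ {n} f g)  =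
  resp-≗ (λ { (_ ∷ _ ∷ _) → refl })
    (primRec (λ k ys → evalPrimBelow f g (head ys) k (tail ys)) (evalBelow-rec f)
      (ifZero-rec (var (suc zero)) (lit 0)
        (evalBelow-rec g ∘-rec
          (var (suc (suc zero)) ∷-rec var zero ∷-rec pred-rec (var (suc zero)) ∷-rec
           (tail-rec ∘ₛ-rec tail-rec ∘ₛ-rec tail-rec))))
      (λ _ → refl) (λ { _ (_ ∷ _) → refl })
     ∘-rec (var (suc zero) ∷-rec var₀ ∷-rec (tail-rec ∘ₛ-rec tail-rec)))
evalBelow-rec (minᵣ f)     =
  pred-rec
    (primRec (λ k ys → search (λ i → evalBelow f (head ys) (i ∷ tail ys)) k) (lit 0)
      (searchStep-rec (var zero)
        (evalBelow-rec f ∘-rec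
          (var (suc (suc zero)) ∷-rec var zero ∷-rec
           (tail-rec ∘ₛ-rec tail-rec ∘ₛ-rec tail-rec)))
        (var (suc zero)))
      (λ _ → refl) (λ { _ (_ ∷ _) → refl })
     -- The bound is passed twice: once as the number of arguments to try, once as the bound for the
     -- evaluations of `f` themselves.
     ∘-rec (var₀ ∷-rec var₀ ∷-rec tail-rec))

preds-rec []       = []-rec
preds-rec (g ∷ gs) = pred-rec (evalBelow-rec g) ∷-rec preds-rec gs

product-rec []       = lit 1
product-rec (g ∷ gs) = *-rec (evalBelow-rec g) (product-rec gs)

ifZero≡suc : ∀ a {b y} → ifZero a 0 b ≡ suc y → a ≢ 0 × b ≡ suc y
ifZero≡suc (suc a) eq = (λ ()) , eq

search-running : ∀ f i → search f i ≡ 0 → ∀ j → j < i → ∃ λ y → f j ≡ suc (suc y)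
search-running f (suc i) eq j j<1+i with search f i in eqᵢ | f i in eqf
... | zero | suc (suc y) with m<1+n⇒m<n∨m≡n j<1+i
...   | inj₁ j<i  = search-running f i eqᵢ j j<i
...   | inj₂ refl = y , eqf

search-found : ∀ f i {k} → search f i ≡ suc (suc k) →
               (∀ j → j < k → ∃ λ y → f j ≡ suc (suc y)) × f k ≡ 1
search-found f (suc i) eq with search f i in eqᵢ | f i in eqf
search-found f (suc i) refl | zero        | suc zero = search-running f i eqᵢ , eqf
search-found f (suc i) refl | suc (suc k) | _        = search-found f i eqᵢ

search≡0 : ∀ f i → (∀ j → j < i → ∃ λ y → f j ≡ suc (suc y)) → search f i ≡ 0
search≡0 f zero    pos = refl
search≡0 f (suc i) pos
  rewrite search≡0 f i (λ j j<i → pos j (m<n⇒m<1+n j<i)) | proj₂ (pos i (n<1+n i)) = refl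

search≡2+k : ∀ f i {k} → (∀ j → j < k → ∃ λ y → f j ≡ suc (suc y)) → f k ≡ 1 →
             k < i → search f i ≡ suc (suc k)
search≡2+k f (suc i) pos fk≡1 k<1+i with m<1+n⇒m<n∨m≡n k<1+i
... | inj₁ k<i  rewrite search≡2+k f i pos fk≡1 k<i = refl
... | inj₂ refl rewrite search≡0 f i pos | fk≡1 = refl

evalBelow-sound : ∀ (f : Rec n) t xs {y} → evalBelow f t xs ≡ suc y → f ⟨ xs ⟩⇓ y
evalAllBelow-sound : ∀ (gs : Vec (Rec n) m) t xs → product (evalAllBelow gs t xs) ≢ 0 →
  Pointwise (λ g y → g ⟨ xs ⟩⇓ y) gs (Vec.map pred (evalAllBelow gs t xs))
evalPrimBelow-sound : ∀ (f : Rec n) g t k xs {y} → evalPrimBelow f g t k xs ≡ suc y →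
  primᵣ f g ⟨ k ∷ xs ⟩⇓ y

evalBelow-sound zeroᵣ        t xs       refl = zero⇓
evalBelow-sound sucᵣ         t (x ∷ []) refl = suc⇓
evalBelow-sound (projᵣ i)    t xs       refl = proj⇓
evalBelow-sound (compᵣ f gs) t xs       eq
  with ifZero≡suc (product (evalAllBelow gs t xs)) eq
... | gs≢0 , f≡y = comp⇓ (evalAllBelow-sound gs t xs gs≢0) (evalBelow-sound f t _ f≡y)
evalBelow-sound (primᵣ f g)  t (k ∷ xs) eq = evalPrimBelow-sound f g t k xs eq
evalBelow-sound (minᵣ f)     t xs       eq
  with search (λ i → evalBelow f t (i ∷ xs)) t in found
-- `pred` sends the running state 0 and the stuck state 1 both to 0, so only a state `2 + k` can
-- produce a value.
evalBelow-sound (minᵣ f)     t xs       refl | suc (suc k)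
  with search-found _ t found
... | pos , f≡1 =
  min⇓ (λ i i<k → proj₁ (pos i i<k) , evalBelow-sound f t (i ∷ xs) (proj₂ (pos i i<k)))
       (evalBelow-sound f t _ f≡1)

evalAllBelow-sound []       t xs ≢0 = []
evalAllBelow-sound (g ∷ gs) t xs ≢0 with evalBelow g t xs in eq
... | zero  = contradiction refl ≢0
... | suc y = evalBelow-sound g t xs eq ∷ evalAllBelow-sound gs t xs
  λ eq → ≢0 (trans (cong (suc y *_) eq) (*-zeroʳ (suc y)))

evalPrimBelow-sound f g t zero    xs eq = primZ⇓ (evalBelow-sound f t xs eq)
evalPrimBelow-sound f g t (suc k) xs eq with evalPrimBelow f g t k xs in eqₖ
... | suc y = primS⇓ (evalPrimBelow-sound f g t k xs eqₖ) (evalBelow-sound g t _ eq)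

-- A derivation has finitely many subderivations, whose evaluations must succeed under one common
-- bound. Facts that hold from a threshold on can be combined by taking the larger threshold.
Eventually : (ℕ → Set) → Set
Eventually P = ∃ λ t₀ → ∀ t → t₀ ≤ t → P t

eventually₂ : ∀ {P Q R : ℕ → Set} → (∀ t → P t → Q t → R t) →
              Eventually P → Eventually Q → Eventually R
eventually₂ f (t₁ , p) (t₂ , q) = t₁ ⊔ t₂ , λ t ≤t →
  f t (p t (m⊔n≤o⇒m≤o t₁ t₂ ≤t)) (q t (m⊔n≤o⇒n≤o t₁ t₂ ≤t))

eventually-all< : ∀ {P : ℕ → ℕ → Set} k → (∀ i → i < k → Eventually (P i)) →
                  Eventually λ t → ∀ i → i < k → P i t
eventually-all< zero    ev = 0 , λ _ _ _ ()
eventually-all< {P} (suc k) ev = eventually₂ {Q = P k}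
  (λ t below at i i<1+k → case-≤ below at (m<1+n⇒m<n∨m≡n i<1+k))
  (eventually-all< k λ i i<k → ev i (m<n⇒m<1+n i<k)) (ev k (n<1+n k))
  where
  case-≤ : ∀ {t i} → (∀ i → i < k → P i t) → P k t → i < k ⊎ i ≡ k → P i t
  case-≤ below at (inj₁ i<k)  = below _ i<k
  case-≤ below at (inj₂ refl) = at

evalBelow-complete : ∀ (f : Rec n) {xs y} → f ⟨ xs ⟩⇓ y →
  Eventually λ t → evalBelow f t xs ≡ suc y
evalAllBelow-complete : ∀ (gs : Vec (Rec n) m) {xs ys} →
  Pointwise (λ g y → g ⟨ xs ⟩⇓ y) gs ys →
  Eventually λ t → evalAllBelow gs t xs ≡ Vec.map suc ys

evalBelow-complete zeroᵣ        zero⇓ = 0 , λ _ _ → refl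
evalBelow-complete sucᵣ         suc⇓  = 0 , λ _ _ → refl
evalBelow-complete (projᵣ i)    proj⇓ = 0 , λ _ _ → refl
evalBelow-complete (compᵣ f gs) {xs} {y} (comp⇓ {ys = ys} ds d) =
  eventually₂ step (evalAllBelow-complete gs ds) (evalBelow-complete f d)
  where
  product-suc : ∀ {k} (zs : Vec ℕ k) → ∃ λ w → product (Vec.map suc zs) ≡ suc w
  product-suc []       = 0 , refl
  product-suc (z ∷ zs) with product-suc zs
  ... | w , eq rewrite eq = _ , refl

  map-pred-suc : ∀ {k} (zs : Vec ℕ k) → Vec.map pred (Vec.map suc zs) ≡ zs
  map-pred-suc []       = refl
  map-pred-suc (z ∷ zs) = cong (z ∷_) (map-pred-suc zs)

  step : ∀ t → evalAllBelow gs t xs ≡ Vec.map suc ys → evalBelow f t ys ≡ suc y →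
         evalBelow (compᵣ f gs) t xs ≡ suc y
  step t eqs eq
    rewrite eqs | proj₂ (product-suc ys) | map-pred-suc ys = eq
evalBelow-complete (primᵣ f g)  (primZ⇓ d) = evalBelow-complete f d
evalBelow-complete (primᵣ f g)  (primS⇓ {k = k} {xs} {y} {z} d e) =
  eventually₂ step (evalBelow-complete (primᵣ f g) d) (evalBelow-complete g e)
  where
  step : ∀ t → evalPrimBelow f g t k xs ≡ suc y → evalBelow g t (k ∷ y ∷ xs) ≡ suc z →
         evalPrimBelow f g t (suc k) xs ≡ suc z
  step t eqₖ eq rewrite eqₖ = eq
evalBelow-complete (minᵣ f) {xs} (min⇓ {k = k} ds d) =
  eventually₂ (λ t (k<t , pos) f≡1 → cong pred (search≡2+k _ t pos f≡1 k<t))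
    -- The bound must also exceed `k`, or the search would end before trying it.
    (eventually₂ (λ _ → _,_) (suc k , λ _ k<t → k<t)
      (eventually-all< k λ i i<k →
        let t₀ , eq = evalBelow-complete f (proj₂ (ds i i<k))
        in t₀ , λ t ≤t → proj₁ (ds i i<k) , eq t ≤t))
    (evalBelow-complete f d)

evalAllBelow-complete []       []       = 0 , λ _ _ → refl
evalAllBelow-complete (g ∷ gs) (d ∷ ds) =
  eventually₂ (λ _ → cong₂ _∷_) (evalBelow-complete g d) (evalAllBelow-complete gs ds)

-- By completeness both results are the value of `evalBelow f` at one sufficiently large bound.
⇓-deterministic : ∀ (f : Rec n) {xs y z} → f ⟨ xs ⟩⇓ y → f ⟨ xs ⟩⇓ z → y ≡ z
⇓-deterministic f d e =
  let t , eq = eventually₂ (λ _ y≡ z≡ → suc-injective (trans (sym y≡) z≡))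
                 (evalBelow-complete f d) (evalBelow-complete f e)
  in eq t ≤-refl

-- Decoding pairs and lists

odd : ℕ → ℕ
odd zero    = 0
odd (suc n) = 1 ∸ odd n

half : ℕ → ℕ
half zero    = 0
half (suc n) = half n + odd n

odd-rec : Recursive₁ odd
odd-rec = prim₁ odd (λ _ p → 1 ∸ p) (λ _ p → ∸-rec (lit 1) p) (λ _ → refl)

half-rec : Recursive₁ half
half-rec = prim₁ half (λ k h → h + odd k) (λ k h → +-rec h (odd-rec k)) (λ _ → refl)

odd-2* : ∀ n → odd (2 * n) ≡ 0
odd-2* zero    = refl
odd-2* (suc n) rewrite +-suc n (n + 0) | odd-2* n = refl

half-2* : ∀ n → half (2 * n) ≡ n
half-2* zero    = refl
half-2* (suc n) rewrite +-suc n (n + 0) | odd-2* n | half-2* n | +-identityʳ n = +-comm n 1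

half-1+2* : ∀ n → half (suc (2 * n)) ≡ n
half-1+2* n rewrite odd-2* n | half-2* n = +-identityʳ n

cons : ℕ → ℕ → ℕ
cons a b = 2 ^ a * suc (2 * b)

cons-rec : Recursive₂ cons
cons-rec a b = *-rec (^-rec (lit 2) a) (suc-rec (*-rec (lit 2) b))

halveIfEven : ℕ → ℕ
halveIfEven x = ifZero (odd x) (half x) x

strip : ℕ → ℕ → ℕ
strip zero    x = x
strip (suc i) x = halveIfEven (strip i x)

halvings : ℕ → ℕ → ℕ
halvings zero    x = 0
halvings (suc i) x = halvings i x + (1 ∸ odd (strip i x))

strip-rec : Recursive₂ strip
strip-rec = prim₂ strip (λ x → x) (λ _ y _ → halveIfEven y) (λ x → x)
  (λ _ y _ → ifZero-rec (odd-rec y) (half-rec y) y) (λ _ → refl) (λ _ _ → refl)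

cons-suc : ∀ a b → cons (suc a) b ≡ 2 * cons a b
cons-suc a b = *-assoc 2 (2 ^ a) (suc (2 * b))

odd-cons : ∀ a b → 1 ∸ odd (cons a b) + pred a ≡ a
odd-cons zero    b rewrite +-identityʳ (2 * b) | odd-2* b = refl
odd-cons (suc a) b rewrite cons-suc a b | odd-2* (cons a b) = refl

halveIfEven-cons : ∀ a b → halveIfEven (cons a b) ≡ cons (pred a) b
halveIfEven-cons zero    b rewrite +-identityʳ (2 * b) | odd-2* b = refl
halveIfEven-cons (suc a) b rewrite cons-suc a b | odd-2* (cons a b) = half-2* (cons a b)

strip-cons : ∀ i a b → strip i (cons a b) ≡ cons (a ∸ i) b
strip-cons zero    a b = refl
strip-cons (suc i) a b rewrite strip-cons i a b | sym (pred[m∸n]≡m∸[1+n] a i) =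
  halveIfEven-cons (a ∸ i) b

-- An invariant: the factors of two already removed and those still left add up to `a`. Once the odd
-- part is reached, nothing more is counted and `a ∸ i` stays 0.
halvings-cons : ∀ i a b → halvings i (cons a b) + (a ∸ i) ≡ a
halvings-cons zero    a b = refl
halvings-cons (suc i) a b
  rewrite strip-cons i a b | sym (pred[m∸n]≡m∸[1+n] a i)
        | +-assoc (halvings i (cons a b)) (1 ∸ odd (cons (a ∸ i) b)) (pred (a ∸ i))
        | odd-cons (a ∸ i) b = halvings-cons i a b

n<2^n : ∀ n → n < 2 ^ n
n<2^n zero    = z<s
n<2^n (suc n) = begin-strict
  suc n             ≡⟨ +-comm 1 n ⟩
  n + 1             <⟨ +-mono-<-≤ (n<2^n n) (m^n>0 2 n) ⟩
  2 ^ n + 2 ^ n     ≡⟨ cong (λ x → 2 ^ n + x) (sym (+-identityʳ (2 ^ n))) ⟩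
  2 ^ suc n         ∎
  where open ≤-Reasoning

head<cons : ∀ a b → a < cons a b
head<cons a b = <-≤-trans (n<2^n a) (m≤m*n (2 ^ a) (suc (2 * b)))

tail<cons : ∀ a b → b < cons a b
tail<cons a b = ≤-trans (s≤s (m≤n*m b 2)) (m≤n*m (suc (2 * b)) (2 ^ a) {{m^n≢0 2 a}})

opaque
  -- The exponent of two in a positive `x` is less than `x`, so `x` rounds of halving are enough to
  -- reach the odd part.
  hd tl : ℕ → ℕ
  hd x = halvings x x
  tl x = half (strip x x)

  hd-rec : Recursive₁ hd
  hd-rec x = prim₂ halvings (λ _ → 0) (λ i y x → y + (1 ∸ odd (strip i x))) (λ _ → lit 0)
    (λ i y x → +-rec y (∸-rec (lit 1) (odd-rec (strip-rec i x))))
    (λ _ → refl) (λ _ _ → refl) x x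

  tl-rec : Recursive₁ tl
  tl-rec x = half-rec (strip-rec x x)

  hd-cons : ∀ a b → hd (cons a b) ≡ a
  hd-cons a b = begin
    hd (cons a b)                        ≡⟨ +-identityʳ _ ⟨
    hd (cons a b) + 0
      ≡⟨ cong (λ x → hd (cons a b) + x) (m≤n⇒m∸n≡0 (<⇒≤ (head<cons a b))) ⟨
    hd (cons a b) + (a ∸ cons a b)       ≡⟨ halvings-cons (cons a b) a b ⟩
    a                                    ∎
    where open ≡-Reasoning

  tl-cons : ∀ a b → tl (cons a b) ≡ b
  tl-cons a b rewrite strip-cons (cons a b) a b
                    | m≤n⇒m∸n≡0 (<⇒≤ (head<cons a b))
                    | +-identityʳ (2 * b) = half-1+2* b

  tl-0 : tl 0 ≡ 0
  tl-0 = refl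

tails : ℕ → ℕ → ℕ
tails zero    x = x
tails (suc j) x = tl (tails j x)

tails-rec : Recursive₂ tails
tails-rec = prim₂ tails (λ x → x) (λ _ y _ → tl y) (λ x → x) (λ _ y _ → tl-rec y)
  (λ _ → refl) (λ _ _ → refl)

-- The step receives a parameter and the position because a monomial must match its `j`-th exponent
-- with the `j`-th coordinate of a tuple.
foldrFrom : (ℕ → ℕ → ℕ → ℕ → ℕ) → ℕ → ℕ → ℕ → List ℕ → ℕ
foldrFrom g b p j []      = b
foldrFrom g b p j (a ∷ l) = g p j a (foldrFrom g b p (suc j) l)

-- A right fold needs the result for the tail, whose code is not the predecessor of the list's code.
-- Counting positions from the far end back to 0 makes the fold a primitive recursion.
module CodeFold (g : ℕ → ℕ → ℕ → ℕ → ℕ) (b : ℕ) where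

  step : ℕ → ℕ → ℕ → ℕ → ℕ
  step j y acc p = ifZero y acc (g p j (hd y) acc)

  -- A code is at least the length of its list, so x bounds the positions;
  -- those beyond the end are skipped.
  loop : ℕ → ℕ → ℕ → ℕ
  loop zero    x p = b
  loop (suc i) x p = step (x ∸ suc i) (tails (x ∸ suc i) x) (loop i x p) p

  foldCode : ℕ → ℕ → ℕ
  foldCode x p = loop x x p

  foldCode-rec : Recursive₄ g → Recursive₂ foldCode
  foldCode-rec g-rec x p = prim₃ loop (λ _ _ → b)
    (λ i acc x p → step (x ∸ suc i) (tails (x ∸ suc i) x) acc p)
    (λ _ _ → lit b)
    (λ i acc x p →
      let j = ∸-rec x (suc-rec i)
          y = tails-rec j x
      in ifZero-rec y acc (g-rec p j (hd-rec y) acc))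
    (λ _ _ → refl) (λ _ _ _ → refl) x x p

  -- After `i` rounds the positions from `j` up to `x` have been folded, and these hold the list `l`
  -- coded by `tails j x`.
  loop-correct : ∀ i j x l p → x ≡ i + j → tails j x ≡ codeList l → length l ≤ i →
                 loop i x p ≡ foldrFrom g b p j l
  loop-correct zero    j x []      p x≡ eq len = refl
  loop-correct (suc i) j x l       p x≡ eq len
    with j≡ ← trans (cong (_∸ suc i) x≡) (m+n∸m≡n (suc i) j)
    rewrite j≡ | eq = cons-case l eq len
    where
    cons-case : ∀ l → tails j x ≡ codeList l → length l ≤ suc i →
                step j (codeList l) (loop i x p) p ≡ foldrFrom g b p j l
    cons-case []      eq len =
      -- Past the end every further tail is 0 again, by `tl-0`.
      loop-correct i (suc j) x [] p (trans x≡ (sym (+-suc i j)))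
        (trans (cong tl eq) tl-0) z≤n
    cons-case (a ∷ l) eq (s≤s len)
      -- `tail<cons` is abstracted along to exclude the case that the code is zero: it would put a
      -- number below 0.
      with cons a (codeList l) | hd-cons a (codeList l) | tl-cons a (codeList l)
         | tail<cons a (codeList l)
    ... | suc c | hd≡ | tl≡ | _ rewrite hd≡ =
      cong (g p j a) (loop-correct i (suc j) x l p (trans x≡ (sym (+-suc i j)))
                       (trans (cong tl eq) tl≡) len)

  length≤code : ∀ l → length l ≤ codeList l
  length≤code []      = z≤n
  length≤code (a ∷ l) = ≤-<-trans (length≤code l) (tail<cons a (codeList l))

  foldCode-codeList : ∀ l p → foldCode (codeList l) p ≡ foldrFrom g b p 0 l
  foldCode-codeList l p =
    loop-correct (codeList l) 0 (codeList l) l p (sym (+-identityʳ _)) refl (length≤code l)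

open CodeFold using (foldCode; foldCode-rec; foldCode-codeList)

-- Rational arithmetic on codes

posPart negPart : ℕ → ℕ
posPart u = ifZero (odd u) (half u) 0
negPart u = ifZero (odd u) 0 (suc (half u))

posPart-rec : Recursive₁ posPart
posPart-rec u = ifZero-rec (odd-rec u) (half-rec u) (lit 0)

negPart-rec : Recursive₁ negPart
negPart-rec u = ifZero-rec (odd-rec u) (lit 0) (suc-rec (half-rec u))

-- Writing integers as differences of naturals lets addition and multiplication proceed without
-- cases on signs.
posPart-negPart : ∀ z → + posPart (codeℤ z) ℤ.- + negPart (codeℤ z) ≡ z
posPart-negPart (+ n) rewrite odd-2* n | half-2* n = ℤ.+-identityʳ (+ n)
posPart-negPart -[1+ n ] rewrite odd-2* n | half-2* n | +-identityʳ n = refl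

-- The fraction (p − n) / (1 + d).
fraction : ℕ → ℕ → ℕ → ℕ
fraction p n d = cons p (cons n d)

fraction-rec : Recursive₃ fraction
fraction-rec p n d = cons-rec p (cons-rec n d)

pos neg den-1 : ℕ → ℕ
pos   u = hd u
neg   u = hd (tl u)
den-1 u = tl (tl u)

neg-rec : Recursive₁ neg
neg-rec u = hd-rec (tl-rec u)

den-1-rec : Recursive₁ den-1
den-1-rec u = tl-rec (tl-rec u)

value : ℕ → ℚᵘ
value u = mkℚᵘ (+ pos u ℤ.- + neg u) (den-1 u)

value-fraction : ∀ p n d → value (fraction p n d) ≡ mkℚᵘ (+ p ℤ.- + n) d
value-fraction p n d
  rewrite hd-cons p (cons n d) | tl-cons p (cons n d) | hd-cons n d | tl-cons n d = refl

infix 4 _denotes_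
-- Comparing up to `≃` allows fractions to stay unreduced, so no gcd has to be programmed.
_denotes_ : ℕ → ℚ → Set
u denotes q = value u ≃ toℚᵘ q

add mul : ℕ → ℕ → ℕ
add u v = fraction (pos u * suc (den-1 v) + pos v * suc (den-1 u))
                   (neg u * suc (den-1 v) + neg v * suc (den-1 u))
                   (pred (suc (den-1 u) * suc (den-1 v)))
mul u v = fraction (pos u * pos v + neg u * neg v) (pos u * neg v + neg u * pos v)
                   (pred (suc (den-1 u) * suc (den-1 v)))

add-rec : Recursive₂ add
add-rec u v = fraction-rec
  (+-rec (*-rec (hd-rec u) (suc-rec (den-1-rec v))) (*-rec (hd-rec v) (suc-rec (den-1-rec u))))
  (+-rec (*-rec (neg-rec u) (suc-rec (den-1-rec v))) (*-rec (neg-rec v) (suc-rec (den-1-rec u))))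
  (pred-rec (*-rec (suc-rec (den-1-rec u)) (suc-rec (den-1-rec v))))

mul-rec : Recursive₂ mul
mul-rec u v = fraction-rec
  (+-rec (*-rec (hd-rec u) (hd-rec v)) (*-rec (neg-rec u) (neg-rec v)))
  (+-rec (*-rec (hd-rec u) (neg-rec v)) (*-rec (neg-rec u) (hd-rec v)))
  (pred-rec (*-rec (suc-rec (den-1-rec u)) (suc-rec (den-1-rec v))))

pos-linear : ∀ a b c d → + (a * b + c * d) ≡ + a ℤ.* + b ℤ.+ + c ℤ.* + d
pos-linear a b c d = trans (ℤ.pos-+ (a * b) (c * d)) (cong₂ ℤ._+_ (ℤ.pos-* a b) (ℤ.pos-* c d))

value-add : ∀ u v → value (add u v) ≡ value u ℚᵘ.+ value v
value-add u v = trans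
  (value-fraction (pos u * suc (den-1 v) + pos v * suc (den-1 u))
                  (neg u * suc (den-1 v) + neg v * suc (den-1 u))
                  (pred (suc (den-1 u) * suc (den-1 v))))
  (cong (λ z → mkℚᵘ z (pred (suc (den-1 u) * suc (den-1 v))))
    (trans
      (cong₂ ℤ._-_ (pos-linear (pos u) (suc (den-1 v)) (pos v) (suc (den-1 u)))
                   (pos-linear (neg u) (suc (den-1 v)) (neg v) (suc (den-1 u))))
      (rearrange (+ pos u) (+ neg u) (+ suc (den-1 u)) (+ pos v) (+ neg v) (+ suc (den-1 v)))))
  where
  rearrange : ∀ p n d p′ n′ d′ →
    (p ℤ.* d′ ℤ.+ p′ ℤ.* d) ℤ.- (n ℤ.* d′ ℤ.+ n′ ℤ.* d) ≡
    (p ℤ.- n) ℤ.* d′ ℤ.+ (p′ ℤ.- n′) ℤ.* d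
  rearrange = solve-∀

value-mul : ∀ u v → value (mul u v) ≡ value u ℚᵘ.* value v
value-mul u v = trans
  (value-fraction (pos u * pos v + neg u * neg v) (pos u * neg v + neg u * pos v)
                  (pred (suc (den-1 u) * suc (den-1 v))))
  (cong (λ z → mkℚᵘ z (pred (suc (den-1 u) * suc (den-1 v))))
    (trans
      (cong₂ ℤ._-_ (pos-linear (pos u) (pos v) (neg u) (neg v))
                   (pos-linear (pos u) (neg v) (neg u) (pos v)))
      (rearrange (+ pos u) (+ neg u) (+ pos v) (+ neg v))))
  where
  rearrange : ∀ p n p′ n′ →
    (p ℤ.* p′ ℤ.+ n ℤ.* n′) ℤ.- (p ℤ.* n′ ℤ.+ n ℤ.* p′) ≡ (p ℤ.- n) ℤ.* (p′ ℤ.- n′)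
  rearrange = solve-∀

add-denotes : ∀ {u v p q} → u denotes p → v denotes q → add u v denotes p ℚ.+ q
add-denotes {u} {v} {p} {q} u≃p v≃q = begin
  value (add u v)          ≡⟨ value-add u v ⟩
  value u ℚᵘ.+ value v     ≈⟨ ℚᵘ.+-cong u≃p v≃q ⟩
  toℚᵘ p ℚᵘ.+ toℚᵘ q       ≈⟨ ℚ.toℚᵘ-homo-+ p q ⟨
  toℚᵘ (p ℚ.+ q)           ∎
  where open ℚᵘ.≃-Reasoning

mul-denotes : ∀ {u v p q} → u denotes p → v denotes q → mul u v denotes p ℚ.* q
mul-denotes {u} {v} {p} {q} u≃p v≃q = begin
  value (mul u v)          ≡⟨ value-mul u v ⟩
  value u ℚᵘ.* value v     ≈⟨ ℚᵘ.*-cong u≃p v≃q ⟩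
  toℚᵘ p ℚᵘ.* toℚᵘ q       ≈⟨ ℚ.toℚᵘ-homo-* p q ⟨
  toℚᵘ (p ℚ.* q)           ∎
  where open ℚᵘ.≃-Reasoning

integer : ℕ → ℕ
integer c = fraction (posPart c) (negPart c) 0

integer-rec : Recursive₁ integer
integer-rec c = fraction-rec (posPart-rec c) (negPart-rec c) (lit 0)

integer-denotes : ∀ z → integer (codeℤ z) denotes fromℤ z
integer-denotes z = ℚᵘ.≃-reflexive (trans
  (value-fraction (posPart (codeℤ z)) (negPart (codeℤ z)) 0)
  (cong (λ y → mkℚᵘ y 0) (posPart-negPart z)))

zero-denotes : integer 0 denotes 0ℚ
zero-denotes = integer-denotes (+ 0)

one-denotes : integer 2 denotes 1ℚ
one-denotes = integer-denotes (+ 1)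

power : ℕ → ℕ → ℕ
-- The argument 2 is `codeℤ (+ 1)`, so this is the fraction 1.
power zero    u = integer 2
power (suc e) u = mul u (power e u)

power-rec : Recursive₂ power
power-rec = prim₂ power (λ _ → integer 2) (λ _ y u → mul u y) (λ _ → lit (integer 2))
  (λ _ y u → mul-rec u y) (λ _ → refl) (λ _ _ → refl)

power-denotes : ∀ e {u q} → u denotes q → power e u denotes q ^ℚ e
power-denotes zero    u≃q = one-denotes
power-denotes (suc e) {u} {q} u≃q =
  mul-denotes {u} {power e u} u≃q (power-denotes e {u} u≃q)

-- Denominators are stored less one. For even `v` the integer is `half v`, hence the `pred`. For odd
-- `v` it is the negative of `suc (half v)`, so `half v` is stored directly and the sign moves to
-- the numerator by a swap.
divide : ℕ → ℕ → ℕ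
divide u v = ifZero (odd v) (fraction (posPart u) (negPart u) (pred (half v)))
                            (fraction (negPart u) (posPart u) (half v))

divide-rec : Recursive₂ divide
divide-rec u v = ifZero-rec (odd-rec v)
  (fraction-rec (posPart-rec u) (negPart-rec u) (pred-rec (half-rec v)))
  (fraction-rec (negPart-rec u) (posPart-rec u) (half-rec v))

divide-positive : ∀ u n →
  divide u (2 * suc n) ≡ fraction (posPart u) (negPart u) n
divide-positive u n rewrite odd-2* (suc n) | half-2* (suc n) = refl

divide-negative : ∀ u n →
  divide u (suc (2 * n)) ≡ fraction (negPart u) (posPart u) n
divide-negative u n rewrite odd-2* n =
  cong (fraction (negPart u) (posPart u)) (trans (+-identityʳ (half (2 * n))) (half-2* n))

divide-denotes : ∀ a b (b≢0 : b ≢ 0ℤ) → divide (codeℤ a) (codeℤ b) denotes quotient a b b≢0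
divide-denotes a (+ zero) b≢0 = contradiction refl b≢0
divide-denotes a b@(+[1+ n ]) b≢0 = begin
    value (divide (codeℤ a) (codeℤ b))
      ≡⟨ cong value (divide-positive (codeℤ a) n) ⟩
    value (fraction (posPart (codeℤ a)) (negPart (codeℤ a)) n)
      ≡⟨ value-fraction (posPart (codeℤ a)) (negPart (codeℤ a)) n ⟩
    mkℚᵘ (+ posPart (codeℤ a) ℤ.- + negPart (codeℤ a)) n
      ≡⟨ cong (λ y → mkℚᵘ y n) (posPart-negPart a) ⟩
    mkℚᵘ a n
      ≡⟨ cong₂ mkℚᵘ (ℤ.*-identityʳ a) (+-identityʳ n) ⟨
    mkℚᵘ a 0 ℚᵘ.* mkℚᵘ (+ 1) n
      ≈⟨ ℚ.toℚᵘ-homo-* (fromℤ a) (ℚ.1/ fromℤ b) ⟨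
    toℚᵘ (quotient a b b≢0) ∎
    where open ℚᵘ.≃-Reasoning
divide-denotes a b@(-[1+ n ]) b≢0 = begin
    value (divide (codeℤ a) (codeℤ b))
      ≡⟨ cong value (divide-negative (codeℤ a) n) ⟩
    value (fraction (negPart (codeℤ a)) (posPart (codeℤ a)) n)
      ≡⟨ value-fraction (negPart (codeℤ a)) (posPart (codeℤ a)) n ⟩
    mkℚᵘ (+ negPart (codeℤ a) ℤ.- + posPart (codeℤ a)) n
      ≡⟨ cong₂ mkℚᵘ
           (trans (negate (+ posPart (codeℤ a)) (+ negPart (codeℤ a)))
                  (cong (ℤ._* -[1+ 0 ]) (posPart-negPart a)))
           (sym (+-identityʳ n)) ⟩
    mkℚᵘ a 0 ℚᵘ.* mkℚᵘ -[1+ 0 ] n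
      ≈⟨ ℚ.toℚᵘ-homo-* (fromℤ a) (ℚ.1/ fromℤ b) ⟨
    toℚᵘ (quotient a b b≢0) ∎
    where
    open ℚᵘ.≃-Reasoning
    negate : ∀ x y → y ℤ.- x ≡ (x ℤ.- y) ℤ.* -[1+ 0 ]
    negate = solve-∀

-- Truncated subtraction both ways: the sum vanishes only if both sides agree.
distance : ℕ → ℕ → ℕ
distance p n = (p ∸ n) + (n ∸ p)

distance-rec : Recursive₂ distance
distance-rec p n = +-rec (∸-rec p n) (∸-rec n p)

distance-refl : ∀ p → distance p p ≡ 0
distance-refl p rewrite n∸n≡0 p = refl

distance≡0 : ∀ p n → distance p n ≡ 0 → p ≡ n
distance≡0 p n eq = ≤-antisym
  (m∸n≡0⇒m≤n (m+n≡0⇒m≡0 (p ∸ n) eq)) (m∸n≡0⇒m≤n (m+n≡0⇒n≡0 (p ∸ n) eq))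

denotes-zero : ∀ u {q} → u denotes q → distance (pos u) (neg u) ≡ 0 ⇔ q ≡ 0ℚ
denotes-zero u {q} u≃q = mk⇔
  (λ eq → ℚ.toℚᵘ-injective (ℚᵘ.≃-trans (ℚᵘ.≃-sym {value u} u≃q)
    (ℚᵘ.↥p≡0⇒p≃0 (value u) (ℤ.i≡j⇒i-j≡0 {+ pos u}
      (cong +_ (distance≡0 (pos u) (neg u) eq))))))
  λ q≡0 → trans
    (cong (distance (pos u)) (sym (ℤ.+-injective
      (ℤ.i-j≡0⇒i≡j (+ pos u) (+ neg u) (ℚᵘ.p≃0⇒↥p≡0 (value u)
        (subst (u denotes_) q≡0 u≃q))))))
    (distance-refl (pos u))

-- Evaluating coded polynomials at tuples from R

computable⇒recursive : ∀ τ → Computable τ → Recursive₁ λ k → codeℤ (τ k)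
computable⇒recursive τ (p , p⇓) k =
  computedBy {f = λ xs → codeℤ (τ (head xs))} p (λ { (k ∷ []) → p⇓ k }) ∘-rec (k ∷-rec []-rec)

module Presentation (τ₁ τ₂ : ℕ → ℤ) (computable₁ : Computable τ₁)
                    (computable₂ : Computable τ₂) (τ₂≢0 : ∀ k → τ₂ k ≢ 0ℤ) where

  element : ℕ → ℚ
  element k = quotient (τ₁ k) (τ₂ k) (τ₂≢0 k)

  entry : ℕ → ℕ
  entry k = divide (codeℤ (τ₁ k)) (codeℤ (τ₂ k))

  entry-rec : Recursive₁ entry
  entry-rec k =
    divide-rec (computable⇒recursive τ₁ computable₁ k) (computable⇒recursive τ₂ computable₂ k)

  -- Every z determines a tuple of each length, since hd and tl never fail.
  point : ∀ n → ℕ → Vec ℚ n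
  point zero    z = []
  point (suc n) z = element (hd z) ∷ point n (tl z)

  monomialStep : ℕ → ℕ → ℕ → ℕ → ℕ
  monomialStep z j e acc = mul (power e (entry (hd (tails j z)))) acc

  monomial : ℕ → ℕ → ℕ
  monomial = foldCode monomialStep (integer 2)

  monomial-rec : Recursive₂ monomial
  monomial-rec = foldCode-rec monomialStep (integer 2) λ z j e acc →
    mul-rec (power-rec e (entry-rec (hd-rec (tails-rec j z)))) acc

  monomial-denotes : ∀ z j (es : Vec ℕ n) →
    foldrFrom monomialStep (integer 2) z j (Vec.toList es) denotes
    Vec.foldr′ ℚ._*_ 1ℚ (Vec.zipWith _^ℚ_ (point n (tails j z)) es)
  monomial-denotes z j []       = one-denotes
  monomial-denotes z j (e ∷ es) = mul-denotes
    {power e (entry (hd (tails j z)))}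
    {foldrFrom monomialStep (integer 2) z (suc j) (Vec.toList es)}
    (power-denotes e {entry (hd (tails j z))} (divide-denotes _ _ (τ₂≢0 (hd (tails j z)))))
    (monomial-denotes z (suc j) es)

  term : ℕ → ℕ → ℕ
  term a z = mul (integer (hd a)) (monomial (tl a) z)

  term-rec : Recursive₂ term
  term-rec a z = mul-rec (integer-rec (hd-rec a)) (monomial-rec (tl-rec a) z)

  term-denotes : ∀ z (t : Term n) → term (codeTerm t) z denotes evalTerm t (point n z)
  term-denotes z (c , es)
    rewrite hd-cons (codeℤ c) (codeList (Vec.toList es))
          | tl-cons (codeℤ c) (codeList (Vec.toList es))
          | foldCode-codeList monomialStep (integer 2) (Vec.toList es) z =
    mul-denotes {integer (codeℤ c)} (integer-denotes c) (monomial-denotes z 0 es)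

  polynomialStep : ℕ → ℕ → ℕ → ℕ → ℕ
  polynomialStep z _ a acc = add (term a z) acc

  polynomial : ℕ → ℕ → ℕ
  polynomial = foldCode polynomialStep (integer 0)

  polynomial-rec : Recursive₂ polynomial
  polynomial-rec = foldCode-rec polynomialStep (integer 0) λ z _ a acc →
    add-rec (term-rec a z) acc

  polynomial-denotes : ∀ z j (D : Polynomial n) →
    foldrFrom polynomialStep (integer 0) z j (List.map codeTerm D) denotes eval D (point n z)
  polynomial-denotes z j []      = zero-denotes
  polynomial-denotes z j (t ∷ D) =
    add-denotes {term (codeTerm t) z}
      {foldrFrom polynomialStep (integer 0) z (suc j) (List.map codeTerm D)}
      (term-denotes z t) (polynomial-denotes z (suc j) D)

  opaque
    -- The length of each exponent list determines how many coordinates of `z` are read, so one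
    -- function handles equations in any number of variables.
    residual : ℕ → ℕ → ℕ
    residual x z = distance (pos (polynomial (tl x) z)) (neg (polynomial (tl x) z))

    residual-rec : Recursive₂ residual
    residual-rec x z =
      let y = polynomial-rec (tl-rec x) z in distance-rec (hd-rec y) (neg-rec y)

    polynomial-code : ∀ m (D : Polynomial (suc m)) z →
      polynomial (tl (code (m , D))) z ≡
      foldrFrom polynomialStep (integer 0) z 0 (List.map codeTerm D)
    polynomial-code m D z = trans
      (cong (λ x → polynomial x z) (tl-cons (suc m) (codeList (List.map codeTerm D))))
      (foldCode-codeList polynomialStep (integer 0) (List.map codeTerm D) z)

    residual≡0 : ∀ m (D : Polynomial (suc m)) z →
                 residual (code (m , D)) z ≡ 0 ⇔ eval D (point (suc m) z) ≡ 0ℚ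
    residual≡0 m D z = denotes-zero (polynomial (tl (code (m , D))) z)
      (subst (_denotes eval D (point (suc m) z)) (sym (polynomial-code m D z))
        (polynomial-denotes z 0 D))

-- The equation with an added variable

addVariable : ∀ {n} → Term n → Term (suc n)
addVariable (c , es) = c , 0 ∷ es

cylinder : Equation → Equation
cylinder (m , D) = suc m , List.map addVariable D

-- In a term code the coefficient comes first, so the new exponent 0 goes right behind the head.
cylinderStep : ℕ → ℕ → ℕ → ℕ → ℕ
cylinderStep _ _ a acc = cons (cons (hd a) (cons 0 (tl a))) acc

opaque
  cylinderCode : ℕ → ℕ
  cylinderCode x = cons (suc (hd x)) (foldCode cylinderStep 0 (tl x) 0)

  cylinderCode-rec : Recursive₁ cylinderCode
  cylinderCode-rec x = cons-rec (suc-rec (hd-rec x))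
    (foldCode-rec cylinderStep 0
      (λ _ _ a acc → cons-rec (cons-rec (hd-rec a) (cons-rec (lit 0) (tl-rec a))) acc)
      (tl-rec x) (lit 0))

  cylinderCode-code : ∀ E → cylinderCode (code E) ≡ code (cylinder E)
  cylinderCode-code (m , D)
    rewrite hd-cons (suc m) (codeList (List.map codeTerm D))
          | tl-cons (suc m) (codeList (List.map codeTerm D))
          | foldCode-codeList cylinderStep 0 (List.map codeTerm D) 0 =
    cong (cons (suc (suc m))) (terms 0 D)
    where
    terms : ∀ {n} j (D : Polynomial n) →
      foldrFrom cylinderStep 0 0 j (List.map codeTerm D) ≡
      codeList (List.map codeTerm (List.map addVariable D))
    terms j []             = refl
    terms j ((c , es) ∷ D) = cong₂ cons
      (cong₂ (λ a b → cons a (cons 0 b))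
        (hd-cons (codeℤ c) (codeList (Vec.toList es)))
        (tl-cons (codeℤ c) (codeList (Vec.toList es))))
      (terms (suc j) D)

eval-addVariable : ∀ (D : Polynomial n) q qs →
                   eval (List.map addVariable D) (q ∷ qs) ≡ eval D qs
eval-addVariable []             q qs = refl
eval-addVariable ((c , es) ∷ D) q qs = cong₂ ℚ._+_
  (cong (fromℤ c ℚ.*_) (ℚ.*-identityˡ (Vec.foldr′ ℚ._*_ 1ℚ (Vec.zipWith _^ℚ_ qs es))))
  (eval-addVariable D q qs)

-- Over a fixed solution `qs`, every `q` in `R` is the head of a solution, so the heads of a
-- complete list would exhaust `R`.
cylinder-finite⇒unsolvable : ∀ {ℓ} {R : Pred ℚ ℓ} → Infinite R → ∀ E →
  AtMostFinitelyManySolutionsIn R (cylinder E) → ¬ HasSolutionIn R E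
cylinder-finite⇒unsolvable infinite (m , D) (l , complete) (qs , qs∈R , D≡0) =
  infinite (List.map head l , λ q q∈R →
    ∈-map⁺ head (complete (q ∷ qs) (q∈R ∷ qs∈R , trans (eval-addVariable D q qs) D≡0)))

unsolvable⇒cylinder-finite : ∀ {ℓ} {R : Pred ℚ ℓ} E →
  ¬ HasSolutionIn R E → AtMostFinitelyManySolutionsIn R (cylinder E)
unsolvable⇒cylinder-finite (m , D) ¬solution =
  [] , λ { (q ∷ qs) (_ ∷ qs∈R , D≡0) →
    contradiction (qs , qs∈R , trans (sym (eval-addVariable D q qs)) D≡0) ¬solution }

-- Unbounded search for a passing test

least-zero : ∀ (f : ℕ → ℕ) t → f t ≡ 0 →
             ∃ λ k → (∀ i → i < k → ∃ λ y → f i ≡ suc y) × f k ≡ 0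
least-zero f zero    ft≡0 = 0 , (λ _ ()) , ft≡0
least-zero f (suc t) ft≡0 with f 0 in f0≡
... | zero  = 0 , (λ _ ()) , f0≡
... | suc y =
  let k , below , fk≡0 = least-zero (λ i → f (suc i)) t ft≡0
  in suc k , (λ { zero _ → y , f0≡ ; (suc i) (s≤s i<k) → below i i<k }) , fk≡0

module UnboundedSearch {test output : ℕ → ℕ → ℕ}
                       (test-rec : Recursive₂ test) (output-rec : Recursive₂ output) where

  private
    tester outputter : Rec 2
    tester    = program (test-rec (var zero) (var (suc zero)))
    outputter = program (output-rec (var zero) (var (suc zero)))

    tester⇓ : ∀ t x → tester ⟨ t ∷ x ∷ [] ⟩⇓ test t x
    tester⇓ t x = computes (test-rec (var zero) (var (suc zero))) (t ∷ x ∷ [])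

    outputter⇓ : ∀ t x → outputter ⟨ t ∷ x ∷ [] ⟩⇓ output t x
    outputter⇓ t x = computes (output-rec (var zero) (var (suc zero))) (t ∷ x ∷ [])

  searcher : Rec 1
  searcher = compᵣ outputter (minᵣ tester ∷ projᵣ zero ∷ [])

  searcher-sound : ∀ {x y} → searcher ⟨ x ∷ [] ⟩⇓ y → ∃ λ t → test t x ≡ 0 × y ≡ output t x
  searcher-sound {x} (comp⇓ (min⇓ {k = t} _ d ∷ proj⇓ ∷ []) e) =
    t , ⇓-deterministic tester (tester⇓ t x) d , ⇓-deterministic outputter e (outputter⇓ t x)

  searcher-halts : ∀ x t → test t x ≡ 0 → Halts searcher (x ∷ [])
  searcher-halts x t eq with least-zero (λ t → test t x) t eq
  -- `min⇓` demands positive values below its result, so the given zero `t` has been traded for the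
  -- least one.
  ... | k , below , at = output k x ,
    comp⇓ (min⇓ (λ i i<k → let y , eq = below i i<k in
                  y , subst (tester ⟨ _ ⟩⇓_) eq (tester⇓ i x))
                (subst (tester ⟨ _ ⟩⇓_) at (tester⇓ k x))
           ∷ proj⇓ ∷ [])
          (outputter⇓ k x)

-- The decision procedure

module Decision {ℓ} (R : Pred ℚ ℓ) (infinite : Infinite R)
                (τ₁ τ₂ : ℕ → ℤ) (computable₁ : Computable τ₁) (computable₂ : Computable τ₂)
                (τ₂≢0 : ∀ k → τ₂ k ≢ 0ℤ)
                (presents : ∀ q → R q ⇔ ∃ λ k → quotient (τ₁ k) (τ₂ k) (τ₂≢0 k) ≡ q)
                (p : Rec 1)
                (enumerates : ∀ x → Codes (AtMostFinitelyManySolutionsIn R) x ⇔ Halts p (x ∷ []))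
                where

  open Presentation τ₁ τ₂ computable₁ computable₂ τ₂≢0
  open Equivalence using (to; from)

  point∈R : ∀ n z → All R (point n z)
  point∈R zero    z = []
  point∈R (suc n) z = from (presents _) (hd z , refl) ∷ point∈R n (tl z)

  point-surjective : ∀ {qs : Vec ℚ n} → All R qs → ∃ λ z → point n z ≡ qs
  point-surjective []             = 0 , refl
  point-surjective (q∈R ∷ qs∈R) with to (presents _) q∈R | point-surjective qs∈R
  ... | k , refl | z , refl = cons k z ,
    cong₂ (λ k z → element k ∷ point _ z) (hd-cons k z) (tl-cons k z)

  accepted : ℕ → ℕ → ℕ
  accepted t x = evalBelow p t (cylinderCode x ∷ [])

  accepted-rec : Recursive₂ accepted
  accepted-rec t x = evalBelow-rec p ∘-rec (t ∷-rec cylinderCode-rec x ∷-rec []-rec)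

  -- `t` is at once the code of a tuple and the bound for `evalBelow`. The product vanishes as soon
  -- as either search succeeds at `t`, and the residual tells which verdict that `t` supports.
  test output : ℕ → ℕ → ℕ
  test   t x = residual x t * ifZero (accepted t x) 1 0
  output t x = ifZero (residual x t) 1 0

  open UnboundedSearch {test} {output}
    (λ t x → *-rec (residual-rec x t) (ifZero-rec (accepted-rec t x) (lit 1) (lit 0)))
    (λ t x → ifZero-rec (residual-rec x t) (lit 1) (lit 0))

  residual⇒solution : ∀ E t → residual (code E) t ≡ 0 → HasSolutionIn R E
  residual⇒solution (m , D) t eq =
    point (suc m) t , point∈R (suc m) t , to (residual≡0 m D t) eq

  solution⇒residual : ∀ E → HasSolutionIn R E → ∃ λ t → residual (code E) t ≡ 0
  solution⇒residual (m , D) (qs , qs∈R , D≡0) with point-surjective qs∈R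
  ... | t , refl = t , from (residual≡0 m D t) D≡0

  accepted⇒unsolvable : ∀ E t {y} → accepted t (code E) ≡ suc y → ¬ HasSolutionIn R E
  accepted⇒unsolvable E t eq
    with from (enumerates _) (_ , evalBelow-sound p t _ eq)
  ... | E′ , finite , code≡
    -- Acceptance only provides some equation `E′` with this code; injectivity of `code` identifies
    -- it with the cylinder.
    with refl ← code-injective {E′} {cylinder E} (trans code≡ (cylinderCode-code E)) =
    cylinder-finite⇒unsolvable infinite E finite

  unsolvable⇒accepted : ∀ E → ¬ HasSolutionIn R E → ∃₂ λ t y → accepted t (code E) ≡ suc y
  unsolvable⇒accepted E ¬solution
    with to (enumerates (cylinderCode (code E)))
            (cylinder E , unsolvable⇒cylinder-finite E ¬solution , sym (cylinderCode-code E))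
  ... | y , p⇓y with evalBelow-complete p p⇓y
  ...   | t , eq = t , y , eq t ≤-refl

  Verdict : Equation → ℕ → Set ℓ
  Verdict E y = (HasSolutionIn R E × y ≡ 1) ⊎ (¬ HasSolutionIn R E × y ≡ 0)

  searcher-verdict : ∀ E {y} → searcher ⟨ code E ∷ [] ⟩⇓ y → Verdict E y
  searcher-verdict E d with searcher-sound d
  ... | t , test≡0 , refl
    with residual (code E) t in eqᵣ | accepted t (code E) in eqₐ
  ...   | zero  | _     = inj₁ (residual⇒solution E t eqᵣ , refl)
  -- A positive residual without acceptance would make the product positive, against `test≡0`; hence
  -- there is no further case.
  ...   | suc _ | suc _ = inj₂ (accepted⇒unsolvable E t eqₐ , refl)

  solvable⇒halts : ∀ E → HasSolutionIn R E → Halts searcher (code E ∷ [])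
  solvable⇒halts E solution =
    let t , eq = solution⇒residual E solution
    in searcher-halts (code E) t (cong (_* ifZero (accepted t (code E)) 1 0) eq)

  unsolvable⇒halts : ∀ E → ¬ HasSolutionIn R E → Halts searcher (code E ∷ [])
  unsolvable⇒halts E ¬solution =
    let t , y , eq = unsolvable⇒accepted E ¬solution
    in searcher-halts (code E) t
         (trans (cong (λ a → residual (code E) t * ifZero a 1 0) eq)
                (*-zeroʳ (residual (code E) t)))

  -- Every output comes with a proof of its verdict, so it is enough that the search halts in the
  -- solvable and in the unsolvable case; the wrong output is refuted by its own verdict.
  decides : Decides searcher (HasSolutionIn R)
  decides E = mk⇔ yes⇒1 1⇒yes , mk⇔ no⇒0 0⇒no
    where
    yes⇒1 : HasSolutionIn R E → searcher ⟨ code E ∷ [] ⟩⇓ 1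
    yes⇒1 solution with solvable⇒halts E solution
    ... | y , d with searcher-verdict E d
    ...   | inj₁ (_ , refl)      = d
    ...   | inj₂ (¬solution , _) = contradiction solution ¬solution

    1⇒yes : searcher ⟨ code E ∷ [] ⟩⇓ 1 → HasSolutionIn R E
    1⇒yes d with searcher-verdict E d
    ... | inj₁ (solution , _) = solution

    no⇒0 : ¬ HasSolutionIn R E → searcher ⟨ code E ∷ [] ⟩⇓ 0
    no⇒0 ¬solution with unsolvable⇒halts E ¬solution
    ... | y , d with searcher-verdict E d
    ...   | inj₁ (solution , _) = contradiction solution ¬solution
    ...   | inj₂ (_ , refl)     = d

    0⇒no : searcher ⟨ code E ∷ [] ⟩⇓ 0 → ¬ HasSolutionIn R E
    0⇒no d with searcher-verdict E d
    ... | inj₂ (¬solution , _) = ¬solution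

theorem2 : ∀ {ℓ} (R : Pred ℚ ℓ) →
    Infinite R →
    ComputablyPresented R →
    RecursivelyEnumerable (Codes (AtMostFinitelyManySolutionsIn R)) →
    ∃ λ p → Decides p (HasSolutionIn R)
theorem2 R infinite (τ₁ , τ₂ , computable₁ , computable₂ , τ₂≢0 , presents) (p , enumerates) =
  _ , Decision.decides R infinite τ₁ τ₂ computable₁ computable₂ τ₂≢0 presents p enumerates
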